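{- Let $q$ be a power of an odd prime, let $n\ge 2$, and let $\mathcal{K}\subseteq\mathbb{F}_q^n$ be a conical Kakeya set. Then $$|\mathcal{K}|\ge\left(\frac{q}{3}\right)^n.$$
   Context: For vectors $\underline{a},\underline{b},\underline{c}\in\mathbb{F}_q^n$ with $\underline{b},\underline{c}$ linearly independent, define a hyperbola $\mathcal{H}=\{\underline{a}+t\underline{b}+t^{ -1}\underline{c}: t\in\mathbb{F}_q^*\}$ and a parabola $\mathcal{P}=\{\underline{a}+t\underline{b}+t^{2}\underline{c}: t\in\mathbb{F}_q\}$. A set $\mathcal{K}\subseteq\mathbb{F}_q^n$ is a conical Kakeya set if for every $\underline{d}\in\mathbb{F}_q^n\setminus\{\underline{0}\}$ there exist $\underline{a},\underline{b},\underline{c}\in\mathbb{F}_q^n$ with $\underline{b},\underline{c}$ linearly independent such that either the hyperbola $\mathcal{H}$ with $\underline{d}\in\{\underline{b},\underline{c}\}$ is contained in $\mathcal{K}$, or the parabola $\mathcal{P}$ with $\underline{d}=\underline{c}$ is contained in $\mathcal{K}$. -}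

module Defs where

open import Data.Nat using (ℕ; _≤_; _^_; _%_)
open import Data.Nat.Primality using (Prime)
open import Data.Fin using (Fin)
open import Data.Vec using (Vec; zipWith; map; replicate)
open import Data.List using (List)
open import Data.List.Membership.Propositional using (_∈_)
open import Data.Product using (Σ; ∃; _×_; _,_)
open import Data.Sum using (_⊎_)
open import Relation.Binary.PropositionalEquality using (_≡_; _≢_)
open import Algebra.Core using (Op₁; Op₂)
open import Algebra.Structures using (IsCommutativeRing)
open import Function.Bundles using (_↔_)

IsOddPrimePower : ℕ → Set
IsOddPrimePower q = Σ ℕ λ p → Σ ℕ λ k → Prime p × p % 2 ≡ 1 × 1 ≤ k × q ≡ p ^ k

record FiniteField (q : ℕ) : Set₁ where
  infixl 6 _+_
  infixl 7 _*_
  field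
    Carrier : Set
    _+_ _*_ : Op₂ Carrier
    -_ : Op₁ Carrier
    0# 1# : Carrier
    isCommutativeRing : IsCommutativeRing _≡_ _+_ _*_ -_ 0# 1#
    0≢1 : 0# ≢ 1#
    inverse : ∀ x → x ≢ 0# → ∃ λ y → x * y ≡ 1#
    enumeration : Fin q ↔ Carrier

module _ {q : ℕ} (F : FiniteField q) where
  open FiniteField F

  Vecs : ℕ → Set
  Vecs n = Vec Carrier n

  module _ {n : ℕ} where
    infixl 6 _⊕_
    infixl 7 _·_
    _⊕_ : Vecs n → Vecs n → Vecs n
    _⊕_ = zipWith _+_

    _·_ : Carrier → Vecs n → Vecs n
    t · v = map (t *_) v

    𝟎 : Vecs n
    𝟎 = replicate n 0#

    LinIndep : Vecs n → Vecs n → Set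
    LinIndep b c = ∀ (l m : Carrier) → l · b ⊕ m · c ≡ 𝟎 → l ≡ 0# × m ≡ 0#

    -- hyperbola {a + t b + t⁻¹ c : t ∈ F*} ⊆ K
    -- (t⁻¹ is written as the unique s with t s = 1; this ranges exactly over t ≠ 0)
    HyperbolaIn : Vecs n → Vecs n → Vecs n → List (Vecs n) → Set
    HyperbolaIn a b c K = ∀ (t s : Carrier) → t * s ≡ 1# → a ⊕ t · b ⊕ s · c ∈ K

    ParabolaIn : Vecs n → Vecs n → Vecs n → List (Vecs n) → Set
    ParabolaIn a b c K = ∀ (t : Carrier) → a ⊕ t · b ⊕ (t * t) · c ∈ K

    -- conical Kakeya set (K given as a duplicate-free list of its elements)
    IsConicalKakeya : List (Vecs n) → Set
    IsConicalKakeya K = ∀ (d : Vecs n) → d ≢ 𝟎 →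
      Σ (Vecs n) λ a → Σ (Vecs n) λ b → Σ (Vecs n) λ c →
        LinIndep b c ×
        ((HyperbolaIn a b c K × (d ≡ b ⊎ d ≡ c)) ⊎ (ParabolaIn a b c K × d ≡ c))

{-# OPTIONS --safe #-}
-- The method of multiplicities.  Fix l.  If K were too small, a dimension count would
-- give a nonzero polynomial f of degree < lq vanishing to order 3l at every point of K.
-- Homogenise f and restrict it to the conic attached to a direction d, parametrised
-- projectively by quadratics so that t = 0 is the point at infinity (0 : d) and every
-- t ≠ 0 is a point of K: for the hyperbola this is (t : c + t a + t² b) (or with b and c
-- exchanged), for the parabola (t² : c + t b + t² a).  For w < l, the order-w Hasse
-- derivatives of f restrict to polynomials in t of degree < 2(lq − w) vanishing to order
-- 3l − w at q − 1 points, hence are zero, also at t = 0.  So the top-degree part of f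
-- vanishes to order l at every d ≠ 0, and being of degree < lq it is zero by the
-- Schwartz–Zippel lemma with multiplicities.  Descending on the degree, f = 0.
-- Therefore C(lq+n−1, n) ≤ C(3l+n−1, n) |K| for all l, and l → ∞ gives the bound.
module Submission where

open import Defs
open import Data.Nat as ℕ using (ℕ; zero; suc; _≤_; _<_; z≤n; s≤s; _!)
import Data.Nat.Properties as ℕ
open import Data.Nat.Primality using (¬prime[0]; ¬prime[1])
open import Data.Nat.Solver renaming (module +-*-Solver to ℕSolver)
open import Data.Fin as Fin using (Fin; zero; suc; funToFin; finToFun)
open import Data.Fin.Properties using (*↔×; injective⇒≤; finToFun-funToFin)
open import Data.List using (List; length; lookup)
open import Data.List.Membership.Propositional using (_∈_)
import Data.List.Relation.Unary.Any as Any
open import Data.List.Relation.Unary.Any.Properties using (lookup-index)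
open import Data.List.Relation.Unary.Unique.Propositional using (Unique)
open import Data.Product using (∃; ∃₂; _×_; _,_; proj₁; proj₂)
open import Data.Product.Function.NonDependent.Propositional using (_×-↔_)
open import Data.Sum using (inj₁; inj₂)
open import Data.Vec using (Vec; []; _∷_; map; sum; zipWith; tabulate; replicate)
open import Data.Vec.Properties using (≡-dec)
open import Data.Vec.Functional using (updateAt)
open import Data.Vec.Functional.Properties using (updateAt-updates; updateAt-minimal)
open import Data.Vec.Relation.Unary.All using (All; []; _∷_)
open import Data.Vec.Relation.Binary.Pointwise.Inductive using (Pointwise; []; _∷_)
open import Data.Empty using (⊥-elim)
open import Function.Bundles using (Inverse; Injection; _↔_; mk↔ₛ′)
open import Function.Properties.Inverse using (↔⇒↣; ↔-sym; ↔-trans)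
open import Relation.Nullary using (yes; no)
open import Relation.Nullary.Decidable using (via-injection)
open import Relation.Binary using (DecidableEquality)
open import Relation.Binary.PropositionalEquality
open import Algebra.Bundles using (CommutativeRing)
import Algebra.Properties.Group as GroupProperties
import Algebra.Solver.Ring.NaturalCoefficients.Default as Solver

sum≤n*max : ∀ {n} (v : Fin (suc n) → ℕ) → ∃ λ i → sum (tabulate v) ≤ suc n ℕ.* v i
sum≤n*max {zero}  v = zero , ℕ.≤-refl
sum≤n*max {suc n} v with sum≤n*max (λ i → v (suc i))
... | i , Σ≤ with ℕ.≤-total (v (suc i)) (v zero)
...   | inj₁ v≤ = zero , ℕ.+-monoʳ-≤ (v zero) (ℕ.≤-trans Σ≤ (ℕ.*-monoʳ-≤ (suc n) v≤))
...   | inj₂ v≤ = suc i , ℕ.+-mono-≤ v≤ Σ≤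

0<sum⇒sum≤n*max : ∀ {n} (v : Fin n → ℕ) → 0 < sum (tabulate v) → ∃ λ i → sum (tabulate v) ≤ n ℕ.* v i
0<sum⇒sum≤n*max {suc n} v _ = sum≤n*max v

sum-updateAt : ∀ {n} (v : Fin n → ℕ) i f →
  sum (tabulate (updateAt v i f)) ℕ.+ v i ≡ sum (tabulate v) ℕ.+ f (v i)
sum-updateAt v zero f = lemma (f (v zero)) (sum (tabulate (λ i → v (suc i)))) (v zero)
  where
  open ℕSolver
  lemma : ∀ a b c → (a ℕ.+ b) ℕ.+ c ≡ (c ℕ.+ b) ℕ.+ a
  lemma = solve 3 (λ a b c → (a :+ b) :+ c := (c :+ b) :+ a) refl
sum-updateAt v (suc i) f = trans (ℕ.+-assoc (v zero) _ _)
  (trans (cong (v zero ℕ.+_) (sum-updateAt (λ i → v (suc i)) i f)) (sym (ℕ.+-assoc (v zero) _ _)))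

sum-replicate : ∀ n l → sum (tabulate {n = n} (λ _ → l)) ≡ n ℕ.* l
sum-replicate zero    l = refl
sum-replicate (suc n) l = cong (l ℕ.+_) (sum-replicate n l)

degree-bound : ∀ {D w l} q′ → D ≤ (3 ℕ.+ q′) ℕ.* l → w < l →
  (D ℕ.∸ w) ℕ.* 2 ≤ (2 ℕ.+ q′) ℕ.* (3 ℕ.* l ℕ.∸ w)
degree-bound {D} {w} {l} q′ D≤ w<l with ℕ.m≤n⇒∃[o]m+o≡n (ℕ.<⇒≤ w<l)
... | e , refl = begin
  (D ℕ.∸ w) ℕ.* 2
    ≤⟨ ℕ.*-monoˡ-≤ 2 (ℕ.∸-monoˡ-≤ w D≤) ⟩
  ((3 ℕ.+ q′) ℕ.* (w ℕ.+ e) ℕ.∸ w) ℕ.* 2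
    ≡⟨ cong (λ z → (z ℕ.∸ w) ℕ.* 2) (solve 3 (λ q w e →
         (con 3 :+ q) :* (w :+ e) := w :+ ((con 2 :+ q) :* w :+ (con 3 :+ q) :* e)) refl q′ w e) ⟩
  (w ℕ.+ ((2 ℕ.+ q′) ℕ.* w ℕ.+ (3 ℕ.+ q′) ℕ.* e) ℕ.∸ w) ℕ.* 2
    ≡⟨ cong (ℕ._* 2) (ℕ.m+n∸m≡n w _) ⟩
  ((2 ℕ.+ q′) ℕ.* w ℕ.+ (3 ℕ.+ q′) ℕ.* e) ℕ.* 2
    ≤⟨ ℕ.m≤m+n _ (q′ ℕ.* e) ⟩
  ((2 ℕ.+ q′) ℕ.* w ℕ.+ (3 ℕ.+ q′) ℕ.* e) ℕ.* 2 ℕ.+ q′ ℕ.* e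
    ≡⟨ solve 3 (λ q w e → ((con 2 :+ q) :* w :+ (con 3 :+ q) :* e) :* con 2 :+ q :* e
         := (con 2 :+ q) :* (con 2 :* w :+ con 3 :* e)) refl q′ w e ⟩
  (2 ℕ.+ q′) ℕ.* (2 ℕ.* w ℕ.+ 3 ℕ.* e)
    ≡⟨ cong ((2 ℕ.+ q′) ℕ.*_) (ℕ.m+n∸m≡n w _) ⟨
  (2 ℕ.+ q′) ℕ.* (w ℕ.+ (2 ℕ.* w ℕ.+ 3 ℕ.* e) ℕ.∸ w)
    ≡⟨ cong (λ z → (2 ℕ.+ q′) ℕ.* (z ℕ.∸ w)) (solve 2 (λ w e →
         w :+ (con 2 :* w :+ con 3 :* e) := con 3 :* (w :+ e)) refl w e) ⟩
  (2 ℕ.+ q′) ℕ.* (3 ℕ.* (w ℕ.+ e) ℕ.∸ w) ∎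
  where
  open ℕ.≤-Reasoning
  open ℕSolver

i<m∸w⇒w+i<m : ∀ {i} m w → i < m ℕ.∸ w → w ℕ.+ i < m
i<m∸w⇒w+i<m m       zero    i< = i<
i<m∸w⇒w+i<m (suc m) (suc w) i< = s≤s (i<m∸w⇒w+i<m m w i<)

-- The number of monomials of degree < D in n variables.
dim : ℕ → ℕ → ℕ
dim n       zero    = 0
dim zero    (suc D) = 1
dim (suc n) (suc D) = dim n (suc D) ℕ.+ dim (suc n) D

module PowerBounds where
  open import Data.Nat using (_+_; _*_; _^_)
  open ℕ.≤-Reasoning
  open ℕSolver

  ^-distribʳ-* : ∀ n a b → (a * b) ^ n ≡ a ^ n * b ^ n
  ^-distribʳ-* zero    a b = refl
  ^-distribʳ-* (suc n) a b = trans (cong (a * b *_) (^-distribʳ-* n a b))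
    (solve 4 (λ a b x y → (a :* b) :* (x :* y) := (a :* x) :* (b :* y)) refl a b (a ^ n) (b ^ n))

  [1+x]^n≤ : ∀ x n → suc x ^ suc n ≤ suc n * suc x ^ n + x ^ suc n
  [1+x]^n≤ x zero    = ℕ.≤-reflexive (solve 1 (λ x → (con 1 :+ x) :* con 1 := con 1 :+ x :* con 1) refl x)
  [1+x]^n≤ x (suc n) = begin
    suc x ^ suc n + x * suc x ^ suc n
      ≤⟨ ℕ.+-monoʳ-≤ (suc x ^ suc n) (ℕ.*-monoʳ-≤ x ([1+x]^n≤ x n)) ⟩
    suc x ^ suc n + x * (suc n * suc x ^ n + x ^ suc n)
      ≤⟨ ℕ.m≤m+n _ (suc n * suc x ^ n) ⟩
    suc x ^ suc n + x * (suc n * suc x ^ n + x ^ suc n) + suc n * suc x ^ n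
      ≡⟨ solve 4 (λ x n y z → (con 1 :+ x) :* y :+ x :* ((con 1 :+ n) :* y :+ z) :+ (con 1 :+ n) :* y
           := (con 2 :+ n) :* ((con 1 :+ x) :* y) :+ x :* z) refl x n (suc x ^ n) (x ^ suc n) ⟩
    suc (suc n) * suc x ^ suc n + x ^ suc (suc n) ∎

  ≤[1+x]^n : ∀ x n → suc n * x ^ n + x ^ suc n ≤ suc x ^ suc n
  ≤[1+x]^n x zero    = ℕ.≤-reflexive (solve 1 (λ x → con 1 :+ x :* con 1 := (con 1 :+ x) :* con 1) refl x)
  ≤[1+x]^n x (suc n) = begin
    suc (suc n) * x ^ suc n + x ^ suc (suc n)
      ≡⟨ solve 3 (λ x n y → (con 2 :+ n) :* (x :* y) :+ x :* (x :* y)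
           := x :* y :+ x :* ((con 1 :+ n) :* y :+ x :* y)) refl x n (x ^ n) ⟩
    x ^ suc n + x * (suc n * x ^ n + x ^ suc n)
      ≤⟨ ℕ.+-mono-≤ (ℕ.^-monoˡ-≤ (suc n) (ℕ.n≤1+n x)) (ℕ.*-monoʳ-≤ x (≤[1+x]^n x n)) ⟩
    suc x ^ suc n + x * suc x ^ suc n ∎

  dim-step : ∀ n D → suc n ! * dim (suc n) (suc D) ≡ suc n * (n ! * dim n (suc D)) + suc n ! * dim (suc n) D
  dim-step n D = solve 4 (λ n f a b → ((con 1 :+ n) :* f) :* (a :+ b)
      := (con 1 :+ n) :* (f :* a) :+ ((con 1 :+ n) :* f) :* b)
    refl n (n !) (dim n (suc D)) (dim (suc n) D)

  D^n≤n!*dim : ∀ n D → suc D ^ n ≤ n ! * dim n (suc D)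
  D^[1+n]≤[1+n]!*dim : ∀ n D → D ^ suc n ≤ suc n ! * dim (suc n) D

  D^n≤n!*dim zero    D = ℕ.≤-refl
  D^n≤n!*dim (suc n) D = D^[1+n]≤[1+n]!*dim n (suc D)

  D^[1+n]≤[1+n]!*dim n zero    = z≤n
  D^[1+n]≤[1+n]!*dim n (suc D) = begin
    suc D ^ suc n                                            ≤⟨ [1+x]^n≤ D n ⟩
    suc n * suc D ^ n + D ^ suc n
      ≤⟨ ℕ.+-mono-≤ (ℕ.*-monoʳ-≤ (suc n) (D^n≤n!*dim n D)) (D^[1+n]≤[1+n]!*dim n D) ⟩
    suc n * (n ! * dim n (suc D)) + suc n ! * dim (suc n) D  ≡⟨ dim-step n D ⟨
    suc n ! * dim (suc n) (suc D)                            ∎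

  n!*dim≤ : ∀ n D → n ! * dim n D ≤ (D + n) ^ n
  n!*dim≤ n zero = ℕ.≤-trans (ℕ.≤-reflexive (ℕ.*-zeroʳ (n !))) z≤n
  n!*dim≤ zero (suc D) = ℕ.≤-refl
  n!*dim≤ (suc n) (suc D) = begin
    suc n ! * dim (suc n) (suc D)                            ≡⟨ dim-step n D ⟩
    suc n * (n ! * dim n (suc D)) + suc n ! * dim (suc n) D
      ≤⟨ ℕ.+-mono-≤ (ℕ.*-monoʳ-≤ (suc n) (n!*dim≤ n (suc D))) (n!*dim≤ (suc n) D) ⟩
    suc n * (suc D + n) ^ n + (D + suc n) ^ suc n
      ≡⟨ cong (λ x → suc n * x ^ n + (D + suc n) ^ suc n) (ℕ.+-suc D n) ⟨
    suc n * (D + suc n) ^ n + (D + suc n) ^ suc n            ≤⟨ ≤[1+x]^n (D + suc n) n ⟩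
    (suc D + suc n) ^ suc n                                  ∎

  limit : ∀ a n k → (∀ M → (a * M) ^ suc n ≤ suc (3 * M) ^ suc n * k) → a ^ suc n ≤ 3 ^ suc n * k
  limit a n k h = ℕ.≮⇒≥ λ 3ᴺk<aᴺ → ℕ.<-irrefl refl (ℕ.*-cancelʳ-≤ M B (M ^ n) ⦃ ℕ.m^n≢0 M n ⦄
    (ℕ.+-cancelʳ-≤ (3 ^ suc n * k * M ^ suc n) _ _ (begin
      M ^ suc n + 3 ^ suc n * k * M ^ suc n   ≤⟨ ℕ.*-monoˡ-≤ (M ^ suc n) 3ᴺk<aᴺ ⟩
      a ^ suc n * M ^ suc n                   ≡⟨ ^-distribʳ-* (suc n) a M ⟨
      (a * M) ^ suc n                         ≤⟨ h M ⟩
      suc (3 * M) ^ suc n * k                 ≤⟨ ℕ.*-monoˡ-≤ k ([1+x]^n≤ (3 * M) n) ⟩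
      (suc n * suc (3 * M) ^ n + (3 * M) ^ suc n) * k
        ≤⟨ ℕ.*-monoˡ-≤ k (ℕ.+-monoˡ-≤ ((3 * M) ^ suc n) (ℕ.*-monoʳ-≤ (suc n) (ℕ.^-monoˡ-≤ n 1+3M≤4M))) ⟩
      (suc n * (4 * M) ^ n + (3 * M) ^ suc n) * k
        ≡⟨ cong₂ (λ x y → (suc n * x + y) * k) (^-distribʳ-* n 4 M) (^-distribʳ-* (suc n) 3 M) ⟩
      (suc n * (4 ^ n * M ^ n) + 3 ^ suc n * M ^ suc n) * k
        ≡⟨ solve 6 (λ s f m t u k → (s :* (f :* m) :+ t :* u) :* k := (s :* f :* k) :* m :+ (t :* k) :* u)
             refl (suc n) (4 ^ n) (M ^ n) (3 ^ suc n) (M ^ suc n) k ⟩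
      B * M ^ n + 3 ^ suc n * k * M ^ suc n   ∎)))
    where
    B M : ℕ
    B = suc n * 4 ^ n * k
    M = suc B
    1+3M≤4M : suc (3 * M) ≤ 4 * M
    1+3M≤4M = ℕ.+-monoˡ-≤ (3 * M) (s≤s z≤n)

  dim-bound⇒power-bound : ∀ a n k → (∀ l → dim (suc n) (a * l) ≤ dim (suc n) (3 * l) * k) →
    a ^ suc n ≤ 3 ^ suc n * k
  dim-bound⇒power-bound a n k h = limit a n k λ M → ℕ.*-cancelˡ-≤ (N ^ N) ⦃ ℕ.m^n≢0 N N ⦄ (begin
    N ^ N * (a * M) ^ N                   ≡⟨ ^-distribʳ-* N N (a * M) ⟨
    (N * (a * M)) ^ N                     ≡⟨ cong (_^ N) (solve 3 (λ n a m → n :* (a :* m) := a :* (n :* m)) refl N a M) ⟩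
    (a * (N * M)) ^ N                     ≤⟨ D^[1+n]≤[1+n]!*dim n (a * (N * M)) ⟩
    N ! * dim N (a * (N * M))             ≤⟨ ℕ.*-monoʳ-≤ (N !) (h (N * M)) ⟩
    N ! * (dim N (3 * (N * M)) * k)       ≡⟨ ℕ.*-assoc (N !) _ k ⟨
    N ! * dim N (3 * (N * M)) * k         ≤⟨ ℕ.*-monoˡ-≤ k (n!*dim≤ N (3 * (N * M))) ⟩
    (3 * (N * M) + N) ^ N * k
      ≡⟨ cong (λ x → x ^ N * k) (solve 2 (λ n m → con 3 :* (n :* m) :+ n := n :* (con 1 :+ con 3 :* m)) refl N M) ⟩
    (N * suc (3 * M)) ^ N * k             ≡⟨ cong (_* k) (^-distribʳ-* N N (suc (3 * M))) ⟩
    N ^ N * suc (3 * M) ^ N * k           ≡⟨ ℕ.*-assoc (N ^ N) _ k ⟩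
    N ^ N * (suc (3 * M) ^ N * k)         ∎)
    where
    N : ℕ
    N = suc n

  oddPrimePower≥3 : ∀ {q} → IsOddPrimePower q → ∃ λ q′ → q ≡ 3 + q′
  oddPrimePower≥3 (zero , _ , p-prime , _) = ⊥-elim (¬prime[0] p-prime)
  oddPrimePower≥3 (suc zero , _ , p-prime , _) = ⊥-elim (¬prime[1] p-prime)
  oddPrimePower≥3 (suc (suc zero) , _ , _ , () , _)
  oddPrimePower≥3 (suc (suc (suc p)) , suc k , _ , _ , _ , refl) =
    let o , e = ℕ.m≤n⇒∃[o]m+o≡n {3} (ℕ.≤-trans (ℕ.m≤m+n 3 p) (ℕ.m≤m*n (3 + p) ((3 + p) ^ k) ⦃ ℕ.m^n≢0 (3 + p) k ⦄))
    in o , sym e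

module Multiplicity {q : ℕ} (F : FiniteField q) where
  open FiniteField F

  commutativeRing : CommutativeRing _ _
  commutativeRing = record { isCommutativeRing = isCommutativeRing }

  open CommutativeRing commutativeRing
    using (+-identityˡ; +-identityʳ; +-assoc; +-comm; +-group; -‿inverseˡ; -‿inverseʳ;
           *-identityˡ; *-comm; zeroˡ; zeroʳ)
  open Solver (CommutativeRing.commutativeSemiring commutativeRing)
    using (solve; _:+_; _:*_; _:=_) renaming (con to :con)

  -- A jet is a power series in a local parameter s, and (x₀ , x₁ , x₂) : Quad stands for
  -- x₀ + x₁ s + x₂ s²; delay is multiplication by s.
  Jet : Set
  Jet = ℕ → Carrier

  Quad : Set
  Quad = Carrier × Carrier × Carrier

  delay : Jet → Jet
  delay g zero    = 0#
  delay g (suc i) = g i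

  mul : Quad → Jet → Jet
  mul (x₀ , x₁ , x₂) g i = x₀ * g i + (x₁ * delay g i + x₂ * delay (delay g) i)

  0≡0+a*0 : ∀ a → 0# ≡ 0# + a * 0#
  0≡0+a*0 = solve 1 (λ a → :con 0 := :con 0 :+ a :* :con 0) refl

  delay-cong : ∀ {g h : Jet} → g ≗ h → delay g ≗ delay h
  delay-cong e zero    = refl
  delay-cong e (suc i) = e i

  delay-linear : ∀ g a h → delay (λ i → g i + a * h i) ≗ λ i → delay g i + a * delay h i
  delay-linear g a h zero    = 0≡0+a*0 a
  delay-linear g a h (suc i) = refl

  delay-mul : ∀ x g → delay (mul x g) ≗ mul x (delay g)
  delay-mul (x₀ , x₁ , x₂) g zero =
    solve 3 (λ x y z → :con 0 := x :* :con 0 :+ (y :* :con 0 :+ z :* :con 0)) refl x₀ x₁ x₂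
  delay-mul x g (suc i) = refl

  mul-cong : ∀ x {g h : Jet} → g ≗ h → mul x g ≗ mul x h
  mul-cong (x₀ , x₁ , x₂) e i = cong₂ _+_ (cong (x₀ *_) (e i))
    (cong₂ _+_ (cong (x₁ *_) (delay-cong e i)) (cong (x₂ *_) (delay-cong (delay-cong e) i)))

  mul-linear : ∀ x g a h → mul x (λ i → g i + a * h i) ≗ λ i → mul x g i + a * mul x h i
  mul-linear (x₀ , x₁ , x₂) g a h i
    rewrite delay-cong (delay-linear g a h) i | delay-linear (delay g) a (delay h) i | delay-linear g a h i =
    solve 10 (λ x y z a g₀ g₁ g₂ h₀ h₁ h₂ →
        x :* (g₀ :+ a :* h₀) :+ (y :* (g₁ :+ a :* h₁) :+ z :* (g₂ :+ a :* h₂))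
          := (x :* g₀ :+ (y :* g₁ :+ z :* g₂)) :+ a :* (x :* h₀ :+ (y :* h₁ :+ z :* h₂)))
      refl x₀ x₁ x₂ a (g i) (delay g i) (delay (delay g) i) (h i) (delay h i) (delay (delay h) i)

  mul-comm : ∀ x y g → mul x (mul y g) ≗ mul y (mul x g)
  mul-comm x@(x₀ , x₁ , x₂) y@(y₀ , y₁ , y₂) g i
    rewrite delay-cong (delay-mul y g) i | delay-mul y (delay g) i | delay-mul y g i
          | delay-cong (delay-mul x g) i | delay-mul x (delay g) i | delay-mul x g i =
    solve 11 (λ x₀ x₁ x₂ y₀ y₁ y₂ a b c d e →
        x₀ :* (y₀ :* a :+ (y₁ :* b :+ y₂ :* c)) :+ (x₁ :* (y₀ :* b :+ (y₁ :* c :+ y₂ :* d))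
          :+ x₂ :* (y₀ :* c :+ (y₁ :* d :+ y₂ :* e)))
        := y₀ :* (x₀ :* a :+ (x₁ :* b :+ x₂ :* c)) :+ (y₁ :* (x₀ :* b :+ (x₁ :* c :+ x₂ :* d))
          :+ y₂ :* (x₀ :* c :+ (x₁ :* d :+ x₂ :* e))))
      refl x₀ x₁ x₂ y₀ y₁ y₂ (g i) (delay g i) (delay (delay g) i)
        (delay (delay (delay g)) i) (delay (delay (delay (delay g))) i)

  delay-zero : ∀ {g : Jet} → (∀ i → g i ≡ 0#) → ∀ i → delay g i ≡ 0#
  delay-zero e zero    = refl
  delay-zero e (suc i) = e i

  mul-zero : ∀ x {g : Jet} → (∀ i → g i ≡ 0#) → ∀ i → mul x g i ≡ 0#
  mul-zero (x₀ , x₁ , x₂) e i rewrite e i | delay-zero e i | delay-zero (delay-zero e) i =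
    solve 3 (λ x y z → x :* :con 0 :+ (y :* :con 0 :+ z :* :con 0) := :con 0) refl x₀ x₁ x₂

  mul-head : ∀ x g → mul x g 0 ≡ proj₁ x * g 0
  mul-head (x₀ , x₁ , x₂) g =
    solve 4 (λ x y z g → x :* g :+ (y :* :con 0 :+ z :* :con 0) := x :* g) refl x₀ x₁ x₂ (g 0)

  -- Poly n D: polynomials of degree < D in n variables, where f ▹ h stands for f + x h
  -- with x the first variable and f free of x.
  infixr 5 _▹_

  data Poly : ℕ → ℕ → Set where
    nil : ∀ {n} → Poly n 0
    con : ∀ {D} → Carrier → Poly 0 (suc D)
    _▹_ : ∀ {n D} → Poly n (suc D) → Poly (suc n) D → Poly (suc n) (suc D)

  𝟘ₚ : ∀ {n D} → Poly n D
  𝟘ₚ {D = zero}      = nil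
  𝟘ₚ {zero} {suc D}  = con 0#
  𝟘ₚ {suc n} {suc D} = 𝟘ₚ ▹ 𝟘ₚ

  infixl 6 _+[_]_

  _+[_]_ : ∀ {n D} → Poly n D → Carrier → Poly n D → Poly n D
  nil     +[ a ] nil     = nil
  con c   +[ a ] con d   = con (c + a * d)
  (f ▹ h) +[ a ] (g ▹ k) = (f +[ a ] g) ▹ (h +[ a ] k)

  -- The same polynomial with a weaker degree bound.
  raise : ∀ {n D} → Poly n D → Poly n (suc D)
  raise nil     = 𝟘ₚ
  raise (con c) = con c
  raise (f ▹ h) = raise f ▹ raise h

  con-injective : ∀ {D c d} → con {D} c ≡ con d → c ≡ d
  con-injective refl = refl

  ▹-injective : ∀ {n D} {f g : Poly n (suc D)} {h k : Poly (suc n) D} → f ▹ h ≡ g ▹ k → f ≡ g × h ≡ k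
  ▹-injective refl = refl , refl

  constant : Carrier → Jet
  constant c zero    = c
  constant c (suc _) = 0#

  power : Quad → ℕ → Carrier → Jet
  power l zero    c = constant c
  power l (suc D) c = mul l (power l D c)

  -- Let Φ be the homogenisation of f to degree D − 1, with l for the homogenising variable.
  -- coeff l X f α i is the coefficient of Z^α s^i in Φ(l(s), X(s) + Z).
  coeff : ∀ {n D} → Quad → Vec Quad n → Poly n D → Vec ℕ n → Jet
  coeff l X nil α i = 0#
  coeff l [] (con {D} c) [] i = power l D c i
  coeff l (x ∷ X) (f ▹ h) (zero ∷ α) i =
    coeff l X f α i + mul x (coeff l (x ∷ X) h (zero ∷ α)) i
  coeff l (x ∷ X) (f ▹ h) (suc j ∷ α) i =
    coeff l (x ∷ X) h (j ∷ α) i + mul x (coeff l (x ∷ X) h (suc j ∷ α)) i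

  power-linear : ∀ l D c a d → power l D (c + a * d) ≗ λ i → power l D c i + a * power l D d i
  power-linear l zero    c a d zero    = refl
  power-linear l zero    c a d (suc i) = 0≡0+a*0 a
  power-linear l (suc D) c a d i =
    trans (mul-cong l (power-linear l D c a d) i) (mul-linear l (power l D c) a (power l D d) i)

  private
    rearrange : ∀ p a r s t → (p + a * r) + (s + a * t) ≡ (p + s) + a * (r + t)
    rearrange = solve 5 (λ p a r s t → (p :+ a :* r) :+ (s :+ a :* t) := (p :+ s) :+ a :* (r :+ t)) refl

  coeff-linear : ∀ {n D} l (X : Vec Quad n) (f : Poly n D) a g α →
    coeff l X (f +[ a ] g) α ≗ λ i → coeff l X f α i + a * coeff l X g α i
  coeff-linear l X nil a nil α i = 0≡0+a*0 a
  coeff-linear l [] (con {D} c) a (con d) [] i = power-linear l D c a d i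
  coeff-linear l (x ∷ X) (f ▹ h) a (g ▹ k) (zero ∷ α) i = trans
    (cong₂ _+_ (coeff-linear l X f a g α i)
      (trans (mul-cong x (coeff-linear l (x ∷ X) h a k (zero ∷ α)) i) (mul-linear x _ a _ i)))
    (rearrange _ a _ _ _)
  coeff-linear l (x ∷ X) (f ▹ h) a (g ▹ k) (suc j ∷ α) i = trans
    (cong₂ _+_ (coeff-linear l (x ∷ X) h a k (j ∷ α) i)
      (trans (mul-cong x (coeff-linear l (x ∷ X) h a k (suc j ∷ α)) i) (mul-linear x _ a _ i)))
    (rearrange _ a _ _ _)

  power-0 : ∀ l D i → power l D 0# i ≡ 0#
  power-0 l zero    zero    = refl
  power-0 l zero    (suc i) = refl
  power-0 l (suc D) i = mul-zero l (power-0 l D) i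

  +-zero : ∀ {a b} → a ≡ 0# → b ≡ 0# → a + b ≡ 0#
  +-zero refl refl = +-identityˡ 0#

  coeff-𝟘 : ∀ {n} D l (X : Vec Quad n) α i → coeff l X (𝟘ₚ {n} {D}) α i ≡ 0#
  coeff-𝟘 zero l X α i = refl
  coeff-𝟘 (suc D) l [] [] i = power-0 l D i
  coeff-𝟘 (suc D) l (x ∷ X) (zero ∷ α) i =
    +-zero (coeff-𝟘 (suc D) l X α i) (mul-zero x (coeff-𝟘 D l (x ∷ X) (zero ∷ α)) i)
  coeff-𝟘 (suc D) l (x ∷ X) (suc j ∷ α) i =
    +-zero (coeff-𝟘 D l (x ∷ X) (j ∷ α) i) (mul-zero x (coeff-𝟘 D l (x ∷ X) (suc j ∷ α)) i)

  mul-+ : ∀ x g h → mul x (λ i → g i + h i) ≗ λ i → mul x g i + mul x h i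
  mul-+ x g h i = trans (mul-cong x (λ j → cong (g j +_) (sym (*-identityˡ (h j)))) i)
    (trans (mul-linear x g 1# h i) (cong (mul x g i +_) (*-identityˡ _)))

  coeff-raise : ∀ {n D} l (X : Vec Quad n) (f : Poly n D) α →
    coeff l X (raise f) α ≗ mul l (coeff l X f α)
  coeff-raise l X nil α i = trans (coeff-𝟘 1 l X α i) (sym (mul-zero l (λ _ → refl) i))
  coeff-raise l [] (con c) [] i = refl
  coeff-raise l (x ∷ X) (f ▹ h) (zero ∷ α) i = trans
    (cong₂ _+_ (coeff-raise l X f α i)
      (trans (mul-cong x (coeff-raise l (x ∷ X) h (zero ∷ α)) i) (mul-comm x l _ i)))
    (sym (mul-+ l _ _ i))
  coeff-raise l (x ∷ X) (f ▹ h) (suc j ∷ α) i = trans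
    (cong₂ _+_ (coeff-raise l (x ∷ X) h (j ∷ α) i)
      (trans (mul-cong x (coeff-raise l (x ∷ X) h (suc j ∷ α)) i) (mul-comm x l _ i)))
    (sym (mul-+ l _ _ i))

  coeff-+raise : ∀ {n D} l (X : Vec Quad n) (f : Poly n (suc D)) a (g : Poly n D) α i →
    coeff l X (f +[ a ] raise g) α i ≡ coeff l X f α i + a * mul l (coeff l X g α) i
  coeff-+raise l X f a g α i = trans (coeff-linear l X f a (raise g) α i)
    (cong (λ z → coeff l X f α i + a * z) (coeff-raise l X g α i))

  -- translate k f is f(k + Z).
  translate : ∀ {n D} → Vec Carrier n → Poly n D → Poly n D
  translate k nil = nil
  translate [] (con c) = con c
  translate (k ∷ ks) (f ▹ h) =
    (translate ks f ▹ translate (k ∷ ks) h) +[ k ] raise (translate (k ∷ ks) h)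

  _+Q_∙_ : Quad → Carrier → Quad → Quad
  (w₀ , w₁ , w₂) +Q k ∙ (x₀ , x₁ , x₂) = w₀ + k * x₀ , w₁ + k * x₁ , w₂ + k * x₂

  mul-+Q : ∀ w k l g → mul (w +Q k ∙ l) g ≗ λ i → mul w g i + k * mul l g i
  mul-+Q (w₀ , w₁ , w₂) k (x₀ , x₁ , x₂) g i =
    solve 10 (λ w₀ w₁ w₂ k x₀ x₁ x₂ a b c →
        (w₀ :+ k :* x₀) :* a :+ ((w₁ :+ k :* x₁) :* b :+ (w₂ :+ k :* x₂) :* c)
        := (w₀ :* a :+ (w₁ :* b :+ w₂ :* c)) :+ k :* (x₀ :* a :+ (x₁ :* b :+ x₂ :* c)))
      refl w₀ w₁ w₂ k x₀ x₁ x₂ (g i) (delay g i) (delay (delay g) i)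

  -- Φ(l, W + l k + Z) depends on f only through f(k + Z), so there is no need to divide by l.
  coeff-translate : ∀ {n D} l (W : Vec Quad n) k (f : Poly n D) α →
    coeff l (zipWith (_+Q_∙ l) W k) f α ≗ coeff l W (translate k f) α
  coeff-translate l W k nil α i = refl
  coeff-translate l [] [] (con c) [] i = refl
  coeff-translate l (w ∷ W) (k ∷ ks) (f ▹ h) (zero ∷ α) i = trans
    (cong₂ _+_ (coeff-translate l W ks f α i)
      (trans (mul-cong (w +Q k ∙ l) (coeff-translate l (w ∷ W) (k ∷ ks) h (zero ∷ α)) i) (mul-+Q w k l _ i)))
    (trans (sym (+-assoc _ _ _))
    (sym (coeff-+raise l (w ∷ W) (translate ks f ▹ translate (k ∷ ks) h) k
      (translate (k ∷ ks) h) (zero ∷ α) i)))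
  coeff-translate l (w ∷ W) (k ∷ ks) (f ▹ h) (suc j ∷ α) i = trans
    (cong₂ _+_ (coeff-translate l (w ∷ W) (k ∷ ks) h (j ∷ α) i)
      (trans (mul-cong (w +Q k ∙ l) (coeff-translate l (w ∷ W) (k ∷ ks) h (suc j ∷ α)) i) (mul-+Q w k l _ i)))
    (trans (sym (+-assoc _ _ _))
    (sym (coeff-+raise l (w ∷ W) (translate ks f ▹ translate (k ∷ ks) h) k
      (translate (k ∷ ks) h) (suc j ∷ α) i)))

  truncate : ∀ {n D} m → Poly n D → Poly n m
  truncate zero    f       = nil
  truncate (suc m) nil     = 𝟘ₚ
  truncate (suc m) (con c) = con c
  truncate (suc m) (f ▹ h) = truncate (suc m) f ▹ truncate m h

  delay-low : ∀ {g : Jet} s {m} → (∀ i → s ℕ.+ i < m → g i ≡ 0#) →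
    ∀ i → s ℕ.+ i < suc m → delay g i ≡ 0#
  delay-low s z zero    _ = refl
  delay-low s {m} z (suc i) p = z i (ℕ.≤-pred (subst (_< suc m) (ℕ.+-suc s i) p))

  mul-low : ∀ {x} {g : Jet} s {m} → proj₁ x ≡ 0# → (∀ i → s ℕ.+ i < m → g i ≡ 0#) →
    ∀ i → s ℕ.+ i < suc m → mul x g i ≡ 0#
  mul-low {_ , x₁ , x₂} {g} s refl z i p
    rewrite delay-low {g} s z i p
          | delay-low {delay g} s (delay-low {g} s z) i (ℕ.m<n⇒m<1+n p) =
    solve 3 (λ a b c → :con 0 :* a :+ (b :* :con 0 :+ c :* :con 0) := :con 0) refl (g i) x₁ x₂

  truncated⇒coeff≡0 : ∀ {n D} m l {W : Vec Quad n} → All (λ w → proj₁ w ≡ 0#) W →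
    (f : Poly n D) → truncate m f ≡ 𝟘ₚ → ∀ α i → sum α ℕ.+ i < m → coeff l W f α i ≡ 0#
  truncated⇒coeff≡0 m l W0 nil _ α i _ = refl
  truncated⇒coeff≡0 (suc m) l [] (con {D} c) e [] i _ =
    trans (cong (λ c → power l D c i) (con-injective e)) (power-0 l D i)
  truncated⇒coeff≡0 (suc m) l (w0 ∷ W0) (f ▹ h) e (zero ∷ α) i p = +-zero
    (truncated⇒coeff≡0 (suc m) l W0 f (proj₁ (▹-injective e)) α i p)
    (mul-low (sum α) w0
      (truncated⇒coeff≡0 m l (w0 ∷ W0) h (proj₂ (▹-injective e)) (zero ∷ α)) i p)
  truncated⇒coeff≡0 (suc m) l (w0 ∷ W0) (f ▹ h) e (suc j ∷ α) i p = +-zero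
    (truncated⇒coeff≡0 m l (w0 ∷ W0) h (proj₂ (▹-injective e)) (j ∷ α) i (ℕ.≤-pred p))
    (mul-low (suc j ℕ.+ sum α) w0
      (truncated⇒coeff≡0 m l (w0 ∷ W0) h (proj₂ (▹-injective e)) (suc j ∷ α)) i p)

  enum : Fin q → Carrier
  enum = Inverse.to enumeration

  enum-injective : ∀ {i j} → enum i ≡ enum j → i ≡ j
  enum-injective = Injection.injective (↔⇒↣ enumeration)

  cancel-nonzero : ∀ {x y} → x ≢ 0# → x * y ≡ 0# → y ≡ 0#
  cancel-nonzero {x} {y} x≢0 e with inverse x x≢0
  ... | z , xz≡1 = begin
    y           ≡⟨ *-identityˡ y ⟨
    1# * y      ≡⟨ cong (_* y) xz≡1 ⟨
    x * z * y   ≡⟨ solve 3 (λ x y z → x :* z :* y := z :* (x :* y)) refl x y z ⟩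
    z * (x * y) ≡⟨ cong (z *_) e ⟩
    z * 0#      ≡⟨ zeroʳ z ⟩
    0#          ∎
    where open ≡-Reasoning

  +-cancel : ∀ c a d → (c + a * d) + (- a) * d ≡ c
  +-cancel c a d = begin
    (c + a * d) + (- a) * d ≡⟨ solve 4 (λ c a b d → (c :+ a :* d) :+ b :* d := c :+ (a :+ b) :* d) refl c a (- a) d ⟩
    c + (a + - a) * d       ≡⟨ cong (λ z → c + z * d) (-‿inverseʳ a) ⟩
    c + 0# * d              ≡⟨ solve 2 (λ c d → c :+ :con 0 :* d := c) refl c d ⟩
    c                       ∎
    where open ≡-Reasoning

  +[]-cancel : ∀ {n D} (f : Poly n D) a g → f +[ a ] g +[ - a ] g ≡ f
  +[]-cancel nil     a nil     = refl
  +[]-cancel (con c) a (con d) = cong con (+-cancel c a d)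
  +[]-cancel (f ▹ h) a (g ▹ k) = cong₂ _▹_ (+[]-cancel f a g) (+[]-cancel h a k)

  +[]-𝟘 : ∀ {n D} (f : Poly n D) a → f +[ a ] 𝟘ₚ ≡ f
  +[]-𝟘 nil     a = refl
  +[]-𝟘 (con c) a = cong con (solve 2 (λ c a → c :+ a :* :con 0 := c) refl c a)
  +[]-𝟘 (f ▹ h) a = cong₂ _▹_ (+[]-𝟘 f a) (+[]-𝟘 h a)

  raise-𝟘 : ∀ {n D} → raise (𝟘ₚ {n} {D}) ≡ 𝟘ₚ
  raise-𝟘 {n}     {zero}  = refl
  raise-𝟘 {zero}  {suc D} = refl
  raise-𝟘 {suc n} {suc D} = cong₂ _▹_ raise-𝟘 raise-𝟘

  ⟨_⟩ : Carrier → Quad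
  ⟨ c ⟩ = c , 0# , 0#

  -- The order-α Hasse derivative of f at p.
  taylor : ∀ {n D} → Vec Carrier n → Poly n D → Vec ℕ n → Carrier
  taylor p f α = coeff ⟨ 1# ⟩ (map ⟨_⟩ p) f α 0

  taylor-zero : ∀ {n D} a (p : Vec Carrier n) (f : Poly n (suc D)) h α →
    taylor (a ∷ p) (f ▹ h) (zero ∷ α) ≡ taylor p f α + a * taylor (a ∷ p) h (zero ∷ α)
  taylor-zero a p f h α = cong (taylor p f α +_)
    (mul-head ⟨ a ⟩ (coeff ⟨ 1# ⟩ (map ⟨_⟩ (a ∷ p)) h (zero ∷ α)))

  taylor-suc : ∀ {n D} a (p : Vec Carrier n) (f : Poly n (suc D)) h j α →
    taylor (a ∷ p) (f ▹ h) (suc j ∷ α) ≡ taylor (a ∷ p) h (j ∷ α) + a * taylor (a ∷ p) h (suc j ∷ α)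
  taylor-suc a p f h j α = cong (taylor (a ∷ p) h (j ∷ α) +_)
    (mul-head ⟨ a ⟩ (coeff ⟨ 1# ⟩ (map ⟨_⟩ (a ∷ p)) h (suc j ∷ α)))

  taylor-raise : ∀ {n D} (p : Vec Carrier n) (f : Poly n D) α → taylor p (raise f) α ≡ taylor p f α
  taylor-raise p f α = trans (coeff-raise ⟨ 1# ⟩ (map ⟨_⟩ p) f α 0)
    (trans (mul-head ⟨ 1# ⟩ (coeff ⟨ 1# ⟩ (map ⟨_⟩ p) f α)) (*-identityˡ _))

  taylor-linear : ∀ {n D} (p : Vec Carrier n) (f : Poly n D) a g α →
    taylor p (f +[ a ] g) α ≡ taylor p f α + a * taylor p g α
  taylor-linear p f a g α = coeff-linear ⟨ 1# ⟩ (map ⟨_⟩ p) f a g α 0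

  taylor-+raise : ∀ {n D} (p : Vec Carrier n) (f : Poly n (suc D)) a g α →
    taylor p (f +[ a ] raise g) α ≡ taylor p f α + a * taylor p g α
  taylor-+raise p f a g α = trans (taylor-linear p f a (raise g) α)
    (cong (λ z → taylor p f α + a * z) (taylor-raise p g α))

  -- f = ρ + (x − a) g, with ρ free of x.
  divide : ∀ {n D} a (f : Poly (suc n) (suc D)) → ∃₂ λ ρ g → f ≡ (ρ ▹ g) +[ - a ] raise g
  divide a (f ▹ nil) = f , nil , cong (_▹ nil) (sym (+[]-𝟘 f (- a)))
  divide a (f ▹ h@(_ ▹ _)) with divide a h
  ... | ρ , g , e = (f +[ a ] raise ρ) , (ρ ▹ g) , cong₂ _▹_ (sym (+[]-cancel f a (raise ρ))) e

  linear-factor-cancel : ∀ {a b r x} → a ≢ b → r ≡ 0# → (r + b * x) + (- a) * x ≡ 0# → x ≡ 0#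
  linear-factor-cancel {a} {b} {_} {x} a≢b refl e = cancel-nonzero
    (λ b-a≡0 → a≢b (sym (GroupProperties.x∙y⁻¹≈ε⇒x≈y +-group b a b-a≡0)))
    (trans (solve 3 (λ a b x → (b :+ a) :* x := (:con 0 :+ b :* x) :+ a :* x) refl (- a) b x) e)

  Vanishing : ∀ {n D} → ℕ → Vec Carrier n → Poly n D → Set
  Vanishing m p f = ∀ α → sum α < m → taylor p f α ≡ 0#

  UniformlyVanishing⇒𝟘 : ℕ → Set
  UniformlyVanishing⇒𝟘 n = ∀ {D} l → D ≤ q ℕ.* l → (f : Poly n D) →
    (∀ p → Vanishing l p f) → f ≡ 𝟘ₚ

  -- At a hyperplane x = a of largest weight the restriction of f vanishes by induction on
  -- the number of variables; dividing by x − a lowers both the degree and that weight by one.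
  vanishing-weighted : ∀ {n} → UniformlyVanishing⇒𝟘 n → ∀ {D} (μ : Fin q → ℕ) →
    D ≤ sum (tabulate μ) → (f : Poly (suc n) D) →
    (∀ i p → Vanishing (μ i) (enum i ∷ p) f) → f ≡ 𝟘ₚ
  vanishing-weighted uniform {zero}  μ _ nil _ = refl
  vanishing-weighted uniform {suc D} μ D<Σ f v with 0<sum⇒sum≤n*max μ (ℕ.≤-trans (s≤s z≤n) D<Σ)
  ... | i , Σ≤qμ with divide (enum i) f
  ... | ρ , g , refl = trans
    (cong₂ (λ ρ g → (ρ ▹ g) +[ - a ] raise g) ρ≡𝟘 g≡𝟘)
    (trans (cong (𝟘ₚ +[ - a ]_) raise-𝟘) (+[]-𝟘 𝟘ₚ (- a)))
    where
    D<qμ = ℕ.≤-trans D<Σ Σ≤qμ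
    a = enum i
    μ′ = updateAt μ i ℕ.pred

    at-zero : ∀ b p α → taylor (b ∷ p) f (zero ∷ α)
      ≡ (taylor p ρ α + b * taylor (b ∷ p) g (zero ∷ α)) + (- a) * taylor (b ∷ p) g (zero ∷ α)
    at-zero b p α = trans (taylor-+raise (b ∷ p) (ρ ▹ g) (- a) g (zero ∷ α))
      (cong (_+ (- a) * taylor (b ∷ p) g (zero ∷ α)) (taylor-zero b p ρ g α))

    at-suc : ∀ b p j α → taylor (b ∷ p) f (suc j ∷ α)
      ≡ (taylor (b ∷ p) g (j ∷ α) + b * taylor (b ∷ p) g (suc j ∷ α)) + (- a) * taylor (b ∷ p) g (suc j ∷ α)
    at-suc b p j α = trans (taylor-+raise (b ∷ p) (ρ ▹ g) (- a) g (suc j ∷ α))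
      (cong (_+ (- a) * taylor (b ∷ p) g (suc j ∷ α)) (taylor-suc b p ρ g j α))

    ρ≡𝟘 : ρ ≡ 𝟘ₚ
    ρ≡𝟘 = uniform (μ i) D<qμ ρ λ p α α< → trans (sym (trans (at-zero a p α) (+-cancel _ a _)))
      (v i p (zero ∷ α) α<)

    taylor-ρ : ∀ p α → taylor p ρ α ≡ 0#
    taylor-ρ p α = trans (cong (λ ρ → taylor p ρ α) ρ≡𝟘) (coeff-𝟘 (suc D) ⟨ 1# ⟩ (map ⟨_⟩ p) α 0)

    quotient-here : ∀ p → Vanishing (ℕ.pred (μ i)) (a ∷ p) g
    quotient-here p (j ∷ α) α< = trans (sym (trans (at-suc a p j α) (+-cancel _ a _)))
      (v i p (suc j ∷ α) (ℕ.≤-trans (s≤s α<) (lemma α<)))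
      where
      lemma : ∀ {x y} → x < ℕ.pred y → suc (ℕ.pred y) ≤ y
      lemma {y = suc y} _ = ℕ.≤-refl

    quotient-elsewhere : ∀ k → k ≢ i → ∀ p → Vanishing (μ k) (enum k ∷ p) g
    quotient-elsewhere k k≢i p = go
      where
      a≢b : a ≢ enum k
      a≢b e = k≢i (sym (enum-injective e))
      go : Vanishing (μ k) (enum k ∷ p) g
      go (zero ∷ α) α< = linear-factor-cancel a≢b (taylor-ρ p α)
        (trans (sym (at-zero (enum k) p α)) (v k p (zero ∷ α) α<))
      go (suc j ∷ α) α< = linear-factor-cancel a≢b (go (j ∷ α) (ℕ.<⇒≤ α<))
        (trans (sym (at-suc (enum k) p j α)) (v k p (suc j ∷ α) α<))

    quotient-vanishing : ∀ k p → Vanishing (μ′ k) (enum k ∷ p) g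
    quotient-vanishing k p α α< with k Fin.≟ i
    ... | yes refl = quotient-here p α (subst (sum α <_) (updateAt-updates i μ) α<)
    ... | no k≢i = quotient-elsewhere k k≢i p α (subst (sum α <_) (updateAt-minimal k i μ k≢i) α<)

    D≤Σ′ : D ≤ sum (tabulate μ′)
    D≤Σ′ = ℕ.+-cancelʳ-≤ (μ i) _ _ (subst (D ℕ.+ μ i ≤_) (sym (sum-updateAt μ i ℕ.pred))
      (lemma (μ i) D<qμ D<Σ))
      where
      lemma : ∀ y {S} → suc D ≤ q ℕ.* y → suc D ≤ S → D ℕ.+ y ≤ S ℕ.+ ℕ.pred y
      lemma zero p _ with () ← subst (suc D ≤_) (ℕ.*-zeroʳ q) p
      lemma (suc y) {S} _ r = subst (_≤ S ℕ.+ y) (sym (ℕ.+-suc D y)) (ℕ.+-monoˡ-≤ y r)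

    g≡𝟘 : g ≡ 𝟘ₚ
    g≡𝟘 = vanishing-weighted uniform μ′ D≤Σ′ g quotient-vanishing

  vanishing-uniform : ∀ n → UniformlyVanishing⇒𝟘 n
  vanishing-uniform zero l _ nil _ = refl
  vanishing-uniform zero zero D≤ (con {D} c) v with () ← subst (suc D ≤_) (ℕ.*-zeroʳ q) D≤
  vanishing-uniform zero (suc l) _ (con {D} c) v = cong con (trans (sym (power-1 D)) (v [] [] (s≤s z≤n)))
    where
    power-1 : ∀ D → power ⟨ 1# ⟩ D c 0 ≡ c
    power-1 zero    = refl
    power-1 (suc D) = trans (mul-head ⟨ 1# ⟩ (power ⟨ 1# ⟩ D c)) (trans (*-identityˡ _) (power-1 D))
  vanishing-uniform (suc n) l D≤ f v = vanishing-weighted (vanishing-uniform n) (λ _ → l)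
    (subst (_ ≤_) (sym (sum-replicate q l)) D≤) f (λ i p → v (enum i ∷ p))

  vanishing-punctured : ∀ {n D} l → D ≤ (q ℕ.∸ 1) ℕ.* l → (f : Poly (suc n) D) →
    (∀ a → a ≢ 0# → ∀ p → Vanishing l (a ∷ p) f) → f ≡ 𝟘ₚ
  vanishing-punctured {n} {D} l D≤ f v = vanishing-weighted (vanishing-uniform n) μ D≤Σ f vμ
    where
    i₀ : Fin q
    i₀ = Inverse.from enumeration 0#
    μ : Fin q → ℕ
    μ = updateAt (λ _ → l) i₀ (λ _ → 0)
    q-pred : ∀ {q} → Fin q → q ≡ suc (q ℕ.∸ 1)
    q-pred {suc q} _ = refl
    D≤Σ : D ≤ sum (tabulate μ)
    D≤Σ = subst (D ≤_) (sym (ℕ.+-cancelʳ-≡ l _ _ (begin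
      sum (tabulate μ) ℕ.+ l                     ≡⟨ sum-updateAt (λ _ → l) i₀ (λ _ → 0) ⟩
      sum (tabulate {n = q} (λ _ → l)) ℕ.+ 0     ≡⟨ ℕ.+-identityʳ _ ⟩
      sum (tabulate {n = q} (λ _ → l))           ≡⟨ sum-replicate q l ⟩
      q ℕ.* l                                    ≡⟨ cong (ℕ._* l) (q-pred i₀) ⟩
      l ℕ.+ (q ℕ.∸ 1) ℕ.* l                      ≡⟨ ℕ.+-comm l _ ⟩
      (q ℕ.∸ 1) ℕ.* l ℕ.+ l                      ∎))) D≤
      where open ≡-Reasoning
    vμ : ∀ i p → Vanishing (μ i) (enum i ∷ p) f
    vμ i p α α< with i Fin.≟ i₀
    ... | yes refl with () ← subst (sum α <_) (updateAt-updates i₀ (λ _ → l)) α<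
    ... | no i≢i₀ = v (enum i) (λ e → i≢i₀ (enum-injective (trans e (sym (Inverse.strictlyInverseˡ enumeration 0#)))))
      p α (subst (sum α <_) (updateAt-minimal i i₀ (λ _ → l) i≢i₀) α<)

  -- The expansion of a quadratic in s = t′ − t.
  recenter : Carrier → Quad → Quad
  recenter t (x₀ , x₁ , x₂) = x₀ + (t * x₁ + t * t * x₂) , x₁ + (t * x₂ + t * x₂) , x₂

  jet : ∀ {E} → Poly 1 E → Carrier → Jet
  jet r t i = taylor (t ∷ []) r (i ∷ [])

  -- G t is the expansion at t of one polynomial of degree < E.
  Realizable : ℕ → (Carrier → Jet) → Set
  Realizable E G = ∃ λ (r : Poly 1 E) → ∀ t → jet r t ≗ G t

  jet-x* : ∀ {E} (r : Poly 1 E) t → jet (𝟘ₚ ▹ r) t ≗ λ i → t * jet r t i + delay (jet r t) i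
  jet-x* {E} r t zero = trans (taylor-zero t [] 𝟘ₚ r [])
    (trans (cong (_+ t * jet r t zero) (coeff-𝟘 (suc E) ⟨ 1# ⟩ [] [] 0)) (+-comm _ _))
  jet-x* r t (suc i) = trans (taylor-suc t [] 𝟘ₚ r i []) (+-comm _ _)

  realizable-mul : ∀ {E G} x → Realizable E G → Realizable (2 ℕ.+ E) (λ t → mul (recenter t x) (G t))
  realizable-mul {E} {G} x@(x₀ , x₁ , x₂) (r , r≗G) = r′ , λ t i → trans (r′-jet t i) (mul-cong (recenter t x) (r≗G t) i)
    where
    r₀ r₁ r′ : Poly 1 (2 ℕ.+ E)
    r₀ = 𝟘ₚ +[ x₀ ] raise (raise r)
    r₁ = r₀ +[ x₁ ] raise (𝟘ₚ ▹ r)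
    r′ = r₁ +[ x₂ ] (𝟘ₚ ▹ 𝟘ₚ ▹ r)
    r′-jet : ∀ t → jet r′ t ≗ mul (recenter t x) (jet r t)
    r′-jet t i = begin
      jet r′ t i
        ≡⟨ taylor-linear p r₁ x₂ (𝟘ₚ ▹ 𝟘ₚ ▹ r) (i ∷ []) ⟩
      jet r₁ t i + x₂ * jet (𝟘ₚ ▹ 𝟘ₚ ▹ r) t i
        ≡⟨ cong₂ _+_ (taylor-+raise p r₀ x₁ (𝟘ₚ ▹ r) (i ∷ [])) (cong (x₂ *_) x²) ⟩
      (jet r₀ t i + x₁ * jet (𝟘ₚ ▹ r) t i) + x₂ * (t * (t * R + R₁) + (t * R₁ + R₂))
        ≡⟨ cong₂ (λ y z → (y + x₁ * z) + x₂ * (t * (t * R + R₁) + (t * R₁ + R₂))) x⁰ (jet-x* r t i) ⟩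
      ((0# + x₀ * R) + x₁ * (t * R + R₁)) + x₂ * (t * (t * R + R₁) + (t * R₁ + R₂))
        ≡⟨ solve 7 (λ x₀ x₁ x₂ t R R₁ R₂ →
             ((:con 0 :+ x₀ :* R) :+ x₁ :* (t :* R :+ R₁)) :+ x₂ :* (t :* (t :* R :+ R₁) :+ (t :* R₁ :+ R₂))
             := (x₀ :+ (t :* x₁ :+ t :* t :* x₂)) :* R :+ ((x₁ :+ (t :* x₂ :+ t :* x₂)) :* R₁ :+ x₂ :* R₂))
             refl x₀ x₁ x₂ t R R₁ R₂ ⟩
      mul (recenter t x) (jet r t) i ∎
      where
      open ≡-Reasoning
      p = t ∷ []
      R = jet r t i
      R₁ = delay (jet r t) i
      R₂ = delay (delay (jet r t)) i
      x⁰ : jet r₀ t i ≡ 0# + x₀ * R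
      x⁰ = trans (taylor-+raise p 𝟘ₚ x₀ (raise r) (i ∷ []))
        (cong₂ (λ y z → y + x₀ * z) (coeff-𝟘 (2 ℕ.+ E) ⟨ 1# ⟩ (map ⟨_⟩ p) (i ∷ []) 0) (taylor-raise p r (i ∷ [])))
      x² : jet (𝟘ₚ ▹ 𝟘ₚ ▹ r) t i ≡ t * (t * R + R₁) + (t * R₁ + R₂)
      x² = trans (jet-x* (𝟘ₚ ▹ r) t i) (cong₂ (λ y z → t * y + z) (jet-x* r t i)
        (trans (delay-cong (jet-x* r t) i) (lemma i)))
        where
        lemma : ∀ i → delay (λ i → t * jet r t i + delay (jet r t) i) i
          ≡ t * delay (jet r t) i + delay (delay (jet r t)) i
        lemma zero    = solve 1 (λ t → :con 0 := t :* :con 0 :+ :con 0) refl t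
        lemma (suc i) = refl

  realizable-0 : ∀ {E G} → (∀ t i → G t i ≡ 0#) → Realizable E G
  realizable-0 {E} G≡0 = 𝟘ₚ , λ t i → trans (coeff-𝟘 E ⟨ 1# ⟩ (map ⟨_⟩ (t ∷ [])) (i ∷ []) 0) (sym (G≡0 t i))

  realizable-+ : ∀ {E G H} → Realizable E G → Realizable E H → Realizable E (λ t i → G t i + H t i)
  realizable-+ (r , r≗) (s , s≗) = (r +[ 1# ] s) , λ t i →
    trans (taylor-linear (t ∷ []) r 1# s (i ∷ [])) (cong₂ _+_ (r≗ t i) (trans (*-identityˡ _) (s≗ t i)))

  realizable-raise : ∀ {E G} → Realizable E G → Realizable (suc E) G
  realizable-raise (r , r≗) = raise r , λ t i → trans (taylor-raise (t ∷ []) r (i ∷ [])) (r≗ t i)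

  realizable-mul-∸ : ∀ {G} D w x → Realizable ((D ℕ.∸ w) ℕ.* 2) G →
    Realizable ((suc D ℕ.∸ w) ℕ.* 2) (λ t → mul (recenter t x) (G t))
  realizable-mul-∸ D zero x ρ = realizable-mul x ρ
  realizable-mul-∸ zero (suc w) x (nil , r≗) = realizable-0 λ t → mul-zero (recenter t x) (λ i → sym (r≗ t i))
  realizable-mul-∸ (suc D) (suc w) x ρ = realizable-mul-∸ D w x ρ

  realizable-power : ∀ l D c → Realizable (suc D ℕ.* 2) (λ t → power (recenter t l) D c)
  realizable-power l zero c = realizable-raise (con c ▹ nil , λ where
    t zero    → trans (taylor-zero t [] (con {0} c) nil []) (solve 2 (λ c t → c :+ t :* :con 0 := c) refl c t)
    t (suc i) → trans (taylor-suc t [] (con {0} c) nil i []) (sym (0≡0+a*0 t)))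
  realizable-power l (suc D) c = realizable-mul l (realizable-power l D c)

  coeff-realizable : ∀ {n D} l (X : Vec Quad n) (f : Poly n D) α →
    Realizable ((D ℕ.∸ sum α) ℕ.* 2) (λ t → coeff (recenter t l) (map (recenter t) X) f α)
  coeff-realizable l X nil α = realizable-0 (λ _ _ → refl)
  coeff-realizable l [] (con {D} c) [] = realizable-power l D c
  coeff-realizable l (x ∷ X) (_▹_ {D = D} f h) (zero ∷ α) = realizable-+ (coeff-realizable l X f α)
    (realizable-mul-∸ D (sum α) x (coeff-realizable l (x ∷ X) h (zero ∷ α)))
  coeff-realizable l (x ∷ X) (_▹_ {D = D} f h) (suc j ∷ α) = realizable-+ (coeff-realizable l (x ∷ X) h (j ∷ α))
    (realizable-mul-∸ D (suc j ℕ.+ sum α) x (coeff-realizable l (x ∷ X) h (suc j ∷ α)))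

  realizable⇒0 : ∀ {E G} m → Realizable E G → E ≤ (q ℕ.∸ 1) ℕ.* m →
    (∀ t → t ≢ 0# → ∀ i → i < m → G t i ≡ 0#) → ∀ t i → G t i ≡ 0#
  realizable⇒0 {E} m (r , r≗) E≤ v t i = trans (sym (r≗ t i))
    (trans (cong (λ r → jet r t i) r≡𝟘) (coeff-𝟘 E ⟨ 1# ⟩ (⟨ t ⟩ ∷ []) (i ∷ []) 0))
    where
    r≡𝟘 : r ≡ 𝟘ₚ
    r≡𝟘 = vanishing-punctured m E≤ r λ where
      a a≢0 [] (i ∷ []) i< → trans (r≗ a i) (v a a≢0 i (subst (_< m) (ℕ.+-identityʳ i) i<))

  factor : ∀ {n} l {X : Vec Quad n} {k} → Pointwise (λ x c → proj₁ x ≡ c * proj₁ l) X k →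
    ∃ λ W → All (λ w → proj₁ w ≡ 0#) W × X ≡ zipWith (_+Q_∙ l) W k
  factor l [] = [] , [] , refl
  factor l@(l₀ , l₁ , l₂) {(x₀ , x₁ , x₂) ∷ _} {c ∷ _} (x₀≡ ∷ p) with factor l p
  ... | W , W0 , refl = (0# , x₁ + - (c * l₁) , x₂ + - (c * l₂)) ∷ W , refl ∷ W0 ,
    cong₂ _∷_ (cong₂ _,_ (trans x₀≡ (sym (+-identityˡ _))) (cong₂ _,_ (sub x₁ (c * l₁)) (sub x₂ (c * l₂)))) refl
    where
    sub : ∀ x y → x ≡ x + - y + y
    sub x y = sym (trans (+-assoc x (- y) y)
      (trans (cong (x +_) (-‿inverseˡ y)) (+-identityʳ x)))

  curve-vanishing : ∀ {n D} m l (X : Vec Quad n) (f : Poly n D) →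
    (∀ t → t ≢ 0# → ∃ λ k → truncate m (translate k f) ≡ 𝟘ₚ ×
      Pointwise (λ x c → proj₁ x ≡ c * proj₁ (recenter t l)) (map (recenter t) X) k) →
    ∀ α → (D ℕ.∸ sum α) ℕ.* 2 ≤ (q ℕ.∸ 1) ℕ.* (m ℕ.∸ sum α) →
    coeff (recenter 0# l) (map (recenter 0#) X) f α 0 ≡ 0#
  curve-vanishing m l X f v α bound =
    realizable⇒0 (m ℕ.∸ sum α) (coeff-realizable l X f α) bound low 0# 0
    where
    low : ∀ t → t ≢ 0# → ∀ i → i < m ℕ.∸ sum α → coeff (recenter t l) (map (recenter t) X) f α i ≡ 0#
    low t t≢0 i i< with v t t≢0
    ... | k , vk , p with factor (recenter t l) p
    ... | W , W0 , e = begin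
      coeff L (map (recenter t) X) f α i      ≡⟨ cong (λ Y → coeff L Y f α i) e ⟩
      coeff L (zipWith (_+Q_∙ L) W k) f α i   ≡⟨ coeff-translate L W k f α i ⟩
      coeff L W (translate k f) α i           ≡⟨ truncated⇒coeff≡0 m L W0 (translate k f) vk α i
                                                  (i<m∸w⇒w+i<m m (sum α) i<) ⟩
      0#                                      ∎
      where
      open ≡-Reasoning
      L = recenter t l

  -- The part of degree exactly D − 1.
  top : ∀ {n D} → Poly n D → Poly n D
  top nil               = nil
  top (con {zero} c)    = con c
  top (con {suc D} c)   = con 0#
  top (f ▹ h)           = top f ▹ top h

  -- Φ(0, d) is the top-degree part of f at d.
  coeff-top : ∀ {n D} l → proj₁ l ≡ 0# → (X : Vec Quad n) (f : Poly n D) → ∀ α →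
    coeff l X f α 0 ≡ taylor (map proj₁ X) (top f) α
  coeff-top l l0 X nil α = refl
  coeff-top l l0 [] (con {zero} c) [] = refl
  coeff-top l l0 [] (con {suc D} c) [] = trans (mul-head l (power l D c))
    (trans (cong (_* power l D c 0) l0) (trans (zeroˡ _) (sym (power-0 ⟨ 1# ⟩ (suc D) 0))))
  coeff-top l l0 (x ∷ X) (f ▹ h) (zero ∷ α) = trans
    (cong₂ _+_ (coeff-top l l0 X f α)
      (trans (mul-head x (coeff l (x ∷ X) h (zero ∷ α))) (cong (proj₁ x *_) (coeff-top l l0 (x ∷ X) h (zero ∷ α)))))
    (sym (taylor-zero (proj₁ x) (map proj₁ X) (top f) (top h) α))
  coeff-top l l0 (x ∷ X) (f ▹ h) (suc j ∷ α) = trans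
    (cong₂ _+_ (coeff-top l l0 (x ∷ X) h (j ∷ α))
      (trans (mul-head x (coeff l (x ∷ X) h (suc j ∷ α))) (cong (proj₁ x *_) (coeff-top l l0 (x ∷ X) h (suc j ∷ α)))))
    (sym (taylor-suc (proj₁ x) (map proj₁ X) (top f) (top h) j α))

  top≡𝟘⇒raise : ∀ {n D} (f : Poly n (suc D)) → top f ≡ 𝟘ₚ → ∃ λ g → f ≡ raise g
  top≡𝟘⇒raise (con {zero} c)  e = nil , e
  top≡𝟘⇒raise (con {suc D} c) e = con c , refl
  top≡𝟘⇒raise (f ▹ nil) e with top≡𝟘⇒raise f (proj₁ (▹-injective e))
  ... | nil , e′ = nil , cong (_▹ nil) e′
  top≡𝟘⇒raise (f ▹ h@(_ ▹ _)) e
    with top≡𝟘⇒raise f (proj₁ (▹-injective e)) | top≡𝟘⇒raise h (proj₂ (▹-injective e))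
  ... | g , e₁ | k , e₂ = g ▹ k , cong₂ _▹_ e₁ e₂

  taylor-top-origin : ∀ {n D} (f : Poly n D) α → suc (sum α) < D →
    taylor (replicate n 0#) (top f) α ≡ 0#
  taylor-top-origin (con {zero} c) [] (s≤s ())
  taylor-top-origin (con {suc D} c) [] _ = power-0 ⟨ 1# ⟩ (suc D) 0
  taylor-top-origin (f ▹ h) (zero ∷ α) p = trans (taylor-zero 0# (replicate _ 0#) (top f) (top h) α)
    (+-zero (taylor-top-origin f α p) (zeroˡ _))
  taylor-top-origin (f ▹ h) (suc j ∷ α) p = trans (taylor-suc 0# (replicate _ 0#) (top f) (top h) j α)
    (+-zero (taylor-top-origin h (j ∷ α) (ℕ.≤-pred p)) (zeroˡ _))

  raise-linear : ∀ {n D} (f : Poly n D) a g → raise (f +[ a ] g) ≡ raise f +[ a ] raise g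
  raise-linear nil     a nil     = sym (+[]-𝟘 𝟘ₚ a)
  raise-linear (con c) a (con d) = refl
  raise-linear (f ▹ h) a (g ▹ k) = cong₂ _▹_ (raise-linear f a g) (raise-linear h a k)

  translate-𝟘 : ∀ {n D} k → translate k (𝟘ₚ {n} {D}) ≡ 𝟘ₚ
  translate-𝟘 {n}     {zero}  k  = refl
  translate-𝟘 {zero}  {suc D} [] = refl
  translate-𝟘 {suc n} {suc D} (k ∷ ks) = trans
    (cong₂ (λ f h → (f ▹ h) +[ k ] raise h) (translate-𝟘 ks) (translate-𝟘 (k ∷ ks)))
    (trans (cong (𝟘ₚ +[ k ]_) raise-𝟘) (+[]-𝟘 𝟘ₚ k))

  translate-raise : ∀ {n D} k (f : Poly n D) → translate k (raise f) ≡ raise (translate k f)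
  translate-raise k nil = translate-𝟘 k
  translate-raise [] (con c) = refl
  translate-raise (k ∷ ks) (f ▹ h) = trans
    (cong₂ (λ f h → (f ▹ h) +[ k ] raise h) (translate-raise ks f) (translate-raise (k ∷ ks) h))
    (sym (raise-linear (translate ks f ▹ translate (k ∷ ks) h) k (raise (translate (k ∷ ks) h))))

  truncate-𝟘 : ∀ {n} D m → truncate m (𝟘ₚ {n} {D}) ≡ 𝟘ₚ
  truncate-𝟘 D zero = refl
  truncate-𝟘 zero (suc m) = refl
  truncate-𝟘 {zero} (suc D) (suc m) = refl
  truncate-𝟘 {suc n} (suc D) (suc m) = cong₂ _▹_ (truncate-𝟘 (suc D) (suc m)) (truncate-𝟘 D m)

  truncate-raise : ∀ {n D} m (f : Poly n D) → truncate m (raise f) ≡ truncate m f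
  truncate-raise zero    f       = refl
  truncate-raise (suc m) nil     = truncate-𝟘 1 (suc m)
  truncate-raise (suc m) (con c) = refl
  truncate-raise (suc m) (f ▹ h) = cong₂ _▹_ (truncate-raise (suc m) f) (truncate-raise m h)

  zipWith₃ : ∀ {n} {A : Set} → (Carrier → Carrier → Carrier → A) →
    Vec Carrier n → Vec Carrier n → Vec Carrier n → Vec A n
  zipWith₃ φ []       []       []       = []
  zipWith₃ φ (a ∷ as) (b ∷ bs) (c ∷ cs) = φ a b c ∷ zipWith₃ φ as bs cs

  zipWith₃-heads : ∀ {n} (φ : Carrier → Carrier → Carrier → Quad) t u v w →
    (∀ a b c → proj₁ (recenter t (φ a b c)) ≡ (a + u * b + v * c) * w) →
    ∀ (a b c : Vec Carrier n) → Pointwise (λ x k → proj₁ x ≡ k * w)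
      (map (recenter t) (zipWith₃ φ a b c)) (_⊕_ F (_⊕_ F a (_·_ F u b)) (_·_ F v c))
  zipWith₃-heads φ t u v w e []       []       []       = []
  zipWith₃-heads φ t u v w e (a ∷ as) (b ∷ bs) (c ∷ cs) = e a b c ∷ zipWith₃-heads φ t u v w e as bs cs

  zipWith₃-at-0 : ∀ {n} (φ : Carrier → Carrier → Carrier → Quad) (a b c : Vec Carrier n) →
    map proj₁ (map (recenter 0#) (zipWith₃ φ a b c)) ≡ zipWith₃ (λ x y z → proj₁ (φ x y z)) a b c
  zipWith₃-at-0 φ []       []       []       = refl
  zipWith₃-at-0 φ (a ∷ as) (b ∷ bs) (c ∷ cs) = cong₂ _∷_
    (solve 3 (λ x y z → x :+ (:con 0 :* y :+ :con 0 :* :con 0 :* z) := x) refl _ _ _)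
    (zipWith₃-at-0 φ as bs cs)

  zipWith₃-second : ∀ {n} (a b c : Vec Carrier n) → zipWith₃ (λ _ y _ → y) a b c ≡ b
  zipWith₃-second []       []       []       = refl
  zipWith₃-second (a ∷ as) (b ∷ bs) (c ∷ cs) = cong (b ∷_) (zipWith₃-second as bs cs)

  zipWith₃-third : ∀ {n} (a b c : Vec Carrier n) → zipWith₃ (λ _ _ z → z) a b c ≡ c
  zipWith₃-third []       []       []       = refl
  zipWith₃-third (a ∷ as) (b ∷ bs) (c ∷ cs) = cong (c ∷_) (zipWith₃-third as bs cs)

  VanishingOn : ∀ {n D} → ℕ → List (Vec Carrier n) → Poly n D → Set
  VanishingOn m K f = ∀ {k} → k ∈ K → truncate m (translate k f) ≡ 𝟘ₚ

  conic-vanishing : ∀ {n D q′} → q ≡ 3 ℕ.+ q′ → ∀ l {K} (f : Poly n D) → D ≤ q ℕ.* l → VanishingOn (3 ℕ.* l) K f →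
    ∀ (φ : Carrier → Carrier → Carrier → Quad) λ₁ λ₂ a b c →
    (∀ t → t ≢ 0# → ∃₂ λ u v → _⊕_ F (_⊕_ F a (_·_ F u b)) (_·_ F v c) ∈ K ×
      ∀ x y z → proj₁ (recenter t (φ x y z)) ≡ (x + u * y + v * z) * proj₁ (recenter t (0# , λ₁ , λ₂))) →
    Vanishing l (zipWith₃ (λ x y z → proj₁ (φ x y z)) a b c) (top f)
  conic-vanishing {q′ = q′} q≡ l {K} f D≤ vK φ λ₁ λ₂ a b c conic α α< = begin
    taylor (zipWith₃ (λ x y z → proj₁ (φ x y z)) a b c) (top f) α
      ≡⟨ cong (λ d → taylor d (top f) α) (zipWith₃-at-0 φ a b c) ⟨
    taylor (map proj₁ (map (recenter 0#) X)) (top f) α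
      ≡⟨ coeff-top (recenter 0# L) (solve 2 (λ x y → :con 0 :+ (:con 0 :* x :+ :con 0 :* :con 0 :* y) := :con 0) refl λ₁ λ₂)
           (map (recenter 0#) X) f α ⟨
    coeff (recenter 0# L) (map (recenter 0#) X) f α 0
      ≡⟨ curve-vanishing (3 ℕ.* l) L X f points α
           (subst (λ z → _ ≤ (z ℕ.∸ 1) ℕ.* _) (sym q≡) (degree-bound q′ (subst (λ z → _ ≤ z ℕ.* l) q≡ D≤) α<)) ⟩
    0# ∎
    where
    open ≡-Reasoning
    L = 0# , λ₁ , λ₂
    X = zipWith₃ φ a b c
    points : ∀ t → t ≢ 0# → ∃ λ k → truncate (3 ℕ.* l) (translate k f) ≡ 𝟘ₚ ×
      Pointwise (λ x c → proj₁ x ≡ c * proj₁ (recenter t L)) (map (recenter t) X) k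
    points t t≢0 with conic t t≢0
    ... | u , v , k∈K , e = _ , vK k∈K , zipWith₃-heads φ t u v (proj₁ (recenter t L)) e a b c

  hyperbola-identity : ∀ t s → t * s ≡ 1# → ∀ x y z →
    z + (t * x + t * t * y) ≡ (x + t * y + s * z) * (0# + (t * 1# + t * t * 0#))
  hyperbola-identity t s ts≡1 x y z = begin
    z + (t * x + t * t * y)          ≡⟨ cong (_+ (t * x + t * t * y)) (*-identityˡ z) ⟨
    1# * z + (t * x + t * t * y)     ≡⟨ cong (λ w → w * z + (t * x + t * t * y)) ts≡1 ⟨
    t * s * z + (t * x + t * t * y)  ≡⟨ solve 5 (λ t s x y z → t :* s :* z :+ (t :* x :+ t :* t :* y)
                                          := (x :+ t :* y :+ s :* z) :* (:con 0 :+ (t :* :con 1 :+ t :* t :* :con 0))) refl t s x y z ⟩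
    (x + t * y + s * z) * (0# + (t * 1# + t * t * 0#)) ∎
    where open ≡-Reasoning

  parabola-identity : ∀ t s → t * s ≡ 1# → ∀ x y z →
    z + (t * y + t * t * x) ≡ (x + s * y + s * s * z) * (0# + (t * 0# + t * t * 1#))
  parabola-identity t s ts≡1 x y z = begin
    z + (t * y + t * t * x)
      ≡⟨ solve 4 (λ t x y z → z :+ (t :* y :+ t :* t :* x)
           := (:con 1 :* :con 1) :* z :+ (:con 1 :* (t :* y) :+ t :* t :* x)) refl t x y z ⟩
    (1# * 1#) * z + (1# * (t * y) + t * t * x)
      ≡⟨ cong (λ w → (w * w) * z + (w * (t * y) + t * t * x)) ts≡1 ⟨
    ((t * s) * (t * s)) * z + ((t * s) * (t * y) + t * t * x)
      ≡⟨ solve 5 (λ t s x y z → ((t :* s) :* (t :* s)) :* z :+ ((t :* s) :* (t :* y) :+ t :* t :* x)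
           := (x :+ s :* y :+ s :* s :* z) :* (:con 0 :+ (t :* :con 0 :+ t :* t :* :con 1))) refl t s x y z ⟩
    (x + s * y + s * s * z) * (0# + (t * 0# + t * t * 1#)) ∎
    where open ≡-Reasoning

  direction-vanishing : ∀ {n D q′} → q ≡ 3 ℕ.+ q′ → ∀ l {K : List (Vec Carrier n)} → IsConicalKakeya F K →
    (f : Poly n D) → D ≤ q ℕ.* l → VanishingOn (3 ℕ.* l) K f →
    ∀ d → d ≢ 𝟎 F → Vanishing l d (top f)
  direction-vanishing q≡ l kakeya f D≤ vK d d≢𝟎 with kakeya d d≢𝟎
  ... | a , b , c , _ , inj₁ (hyp , inj₁ refl) =
    subst (λ d → Vanishing l d (top f)) (zipWith₃-second a b c)
      (conic-vanishing q≡ l f D≤ vK (λ x y z → y , x , z) 1# 0# a b c λ t t≢0 →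
        let s , ts≡1 = inverse t t≢0 in s , t , hyp s t (trans (*-comm s t) ts≡1) ,
        λ x y z → trans (hyperbola-identity t s ts≡1 x z y)
          (cong (_* (0# + (t * 1# + t * t * 0#)))
            (solve 3 (λ x y z → x :+ y :+ z := x :+ z :+ y) refl x (t * z) (s * y))))
  ... | a , b , c , _ , inj₁ (hyp , inj₂ refl) =
    subst (λ d → Vanishing l d (top f)) (zipWith₃-third a b c)
      (conic-vanishing q≡ l f D≤ vK (λ x y z → z , x , y) 1# 0# a b c λ t t≢0 →
        let s , ts≡1 = inverse t t≢0 in t , s , hyp t s ts≡1 , hyperbola-identity t s ts≡1)
  ... | a , b , c , _ , inj₂ (par , refl) =
    subst (λ d → Vanishing l d (top f)) (zipWith₃-third a b c)
      (conic-vanishing q≡ l f D≤ vK (λ x y z → z , y , x) 0# 1# a b c λ t t≢0 →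
        let s , ts≡1 = inverse t t≢0 in s , s * s , par s , parabola-identity t s ts≡1)

  _≟_ : DecidableEquality Carrier
  _≟_ = via-injection (↔⇒↣ (↔-sym enumeration)) Fin._≟_

  -- The hypothesis says nothing about the origin.  There the homogeneous top part vanishes to
  -- order l if its degree D is at least l, and otherwise D is so small that the points off a
  -- hyperplane through the origin suffice.
  vanishingOn⇒𝟘 : ∀ {n D q′} → q ≡ 3 ℕ.+ q′ → ∀ l {K : List (Vec Carrier (suc n))} → IsConicalKakeya F K →
    (f : Poly (suc n) D) → D ≤ q ℕ.* l → VanishingOn (3 ℕ.* l) K f → f ≡ 𝟘ₚ
  vanishingOn⇒𝟘 {D = zero} q≡ l kakeya nil D≤ vK = refl
  vanishingOn⇒𝟘 {n} {suc D} {q′} q≡ l {K} kakeya f D≤ vK with top≡𝟘⇒raise f top≡𝟘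
    where
    direction : ∀ d → d ≢ 𝟎 F → Vanishing l d (top f)
    direction = direction-vanishing q≡ l kakeya f D≤ vK
    top≡𝟘 : top f ≡ 𝟘ₚ
    top≡𝟘 with ℕ.≤-<-connex (suc D) ((q ℕ.∸ 1) ℕ.* l)
    ... | inj₁ D< = vanishing-punctured l D< (top f)
            (λ { a a≢0 p → direction (a ∷ p) (λ { refl → a≢0 refl }) })
    ... | inj₂ <D = vanishing-uniform (suc n) l D≤ (top f) vanish
      where
      l≤D : l ≤ D
      l≤D = ℕ.≤-trans (subst (λ z → l ≤ (z ℕ.∸ 1) ℕ.* l) (sym q≡) (ℕ.m≤m+n l _)) (ℕ.≤-pred <D)
      vanish : ∀ p → Vanishing l p (top f)
      vanish p with ≡-dec _≟_ p (𝟎 F)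
      ... | no p≢𝟎   = direction p p≢𝟎
      ... | yes refl = λ α α< → taylor-top-origin f α (s≤s (ℕ.≤-trans α< l≤D))
  ... | g , refl = trans (cong raise g≡𝟘) raise-𝟘
    where
    g≡𝟘 : g ≡ 𝟘ₚ
    g≡𝟘 = vanishingOn⇒𝟘 q≡ l kakeya g (ℕ.<⇒≤ D≤) λ {k} k∈K → begin
      truncate (3 ℕ.* l) (translate k g)           ≡⟨ truncate-raise (3 ℕ.* l) (translate k g) ⟨
      truncate (3 ℕ.* l) (raise (translate k g))   ≡⟨ cong (truncate (3 ℕ.* l)) (translate-raise k g) ⟨
      truncate (3 ℕ.* l) (translate k (raise g))   ≡⟨ vK k∈K ⟩
      𝟘ₚ                                           ∎
      where open ≡-Reasoning

  ▹-uncurried : ∀ {n D} → Poly (suc n) (suc D) ↔ (Poly n (suc D) × Poly (suc n) D)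
  ▹-uncurried = mk↔ₛ′ (λ { (f ▹ h) → f , h }) (λ (f , h) → f ▹ h) (λ _ → refl) (λ { (_ ▹ _) → refl })

  Poly↔Fin : ∀ n D → Poly n D ↔ Fin (q ℕ.^ dim n D)
  Poly↔Fin n zero = mk↔ₛ′ (λ _ → zero) (λ _ → nil) (λ { zero → refl }) (λ { nil → refl })
  Poly↔Fin zero (suc D) = subst (λ N → Poly 0 (suc D) ↔ Fin N) (sym (ℕ.*-identityʳ q))
    (↔-trans (mk↔ₛ′ (λ { (con c) → c }) con (λ _ → refl) (λ { (con _) → refl })) (↔-sym enumeration))
  Poly↔Fin (suc n) (suc D) = subst (λ N → Poly (suc n) (suc D) ↔ Fin N)
    (sym (ℕ.^-distribˡ-+-* q (dim n (suc D)) (dim (suc n) D)))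
    (↔-trans ▹-uncurried
      (↔-trans (Poly↔Fin n (suc D) ×-↔ Poly↔Fin (suc n) D) (↔-sym *↔×)))

  +[]-interchange : ∀ {n D} (f : Poly n D) a g b h k →
    (f +[ a ] g) +[ b ] (h +[ a ] k) ≡ (f +[ b ] h) +[ a ] (g +[ b ] k)
  +[]-interchange nil a nil b nil nil = refl
  +[]-interchange (con c) a (con d) b (con e) (con f) = cong con
    (solve 6 (λ c a d b e f → (c :+ a :* d) :+ b :* (e :+ a :* f) := (c :+ b :* e) :+ a :* (d :+ b :* f)) refl c a d b e f)
  +[]-interchange (f ▹ f′) a (g ▹ g′) b (h ▹ h′) (k ▹ k′) =
    cong₂ _▹_ (+[]-interchange f a g b h k) (+[]-interchange f′ a g′ b h′ k′)

  translate-linear : ∀ {n D} k (f : Poly n D) a g → translate k (f +[ a ] g) ≡ translate k f +[ a ] translate k g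
  translate-linear k nil a nil = refl
  translate-linear [] (con c) a (con d) = refl
  translate-linear (k ∷ ks) (f ▹ f′) a (g ▹ g′) = trans
    (cong₂ (λ f h → (f ▹ h) +[ k ] raise h) (translate-linear ks f a g) (translate-linear (k ∷ ks) f′ a g′))
    (trans (cong ((translate ks f ▹ translate (k ∷ ks) f′) +[ a ] (translate ks g ▹ translate (k ∷ ks) g′) +[ k ]_)
        (raise-linear (translate (k ∷ ks) f′) a (translate (k ∷ ks) g′)))
      (+[]-interchange (translate ks f ▹ translate (k ∷ ks) f′) a _ k _ _))

  truncate-linear : ∀ {n D} m (f : Poly n D) a g → truncate m (f +[ a ] g) ≡ truncate m f +[ a ] truncate m g
  truncate-linear zero    f       a g       = refl
  truncate-linear (suc m) nil     a nil     = sym (+[]-𝟘 𝟘ₚ a)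
  truncate-linear (suc m) (con c) a (con d) = refl
  truncate-linear (suc m) (f ▹ h) a (g ▹ k) = cong₂ _▹_ (truncate-linear (suc m) f a g) (truncate-linear m h a k)

  f-f≡𝟘 : ∀ {n D} (f : Poly n D) → f +[ - 1# ] f ≡ 𝟘ₚ
  f-f≡𝟘 nil     = refl
  f-f≡𝟘 (con c) = cong con (trans
    (solve 2 (λ c e → c :+ e :* c := (:con 1 :+ e) :* c) refl c (- 1#))
    (trans (cong (_* c) (-‿inverseʳ 1#)) (zeroˡ c)))
  f-f≡𝟘 (f ▹ h) = cong₂ _▹_ (f-f≡𝟘 f) (f-f≡𝟘 h)

  f-g≡𝟘⇒f≡g : ∀ {n D} (f g : Poly n D) → f +[ - 1# ] g ≡ 𝟘ₚ → f ≡ g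
  f-g≡𝟘⇒f≡g nil     nil     _ = refl
  f-g≡𝟘⇒f≡g (con c) (con d) e = cong con (begin
    c                          ≡⟨ solve 1 (λ c → c := c :+ :con 0) refl c ⟩
    c + 0#                     ≡⟨ cong (c +_) (zeroˡ d) ⟨
    c + 0# * d                 ≡⟨ cong (λ z → c + z * d) (-‿inverseˡ 1#) ⟨
    c + (- 1# + 1#) * d        ≡⟨ solve 3 (λ c e d → c :+ (e :+ :con 1) :* d := (c :+ e :* d) :+ d) refl c (- 1#) d ⟩
    (c + (- 1#) * d) + d       ≡⟨ cong (_+ d) (con-injective e) ⟩
    0# + d                     ≡⟨ +-identityˡ d ⟩
    d                          ∎)
    where open ≡-Reasoning
  f-g≡𝟘⇒f≡g (f ▹ f′) (g ▹ g′) e =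
    cong₂ _▹_ (f-g≡𝟘⇒f≡g f g (proj₁ (▹-injective e))) (f-g≡𝟘⇒f≡g f′ g′ (proj₂ (▹-injective e)))

  unisolvent⇒dim≤ : 1 < q → ∀ {n} D m (K : List (Vec Carrier n)) →
    ((f : Poly n D) → VanishingOn m K f → f ≡ 𝟘ₚ) → dim n D ≤ dim n m ℕ.* length K
  unisolvent⇒dim≤ 1<q {n} D m K unisolvent = ℕ.≮⇒≥ λ lt → ℕ.<⇒≱ (ℕ.^-monoʳ-< q 1<q lt)
    (subst (q ℕ.^ dim n D ≤_) (ℕ.^-*-assoc q (dim n m) (length K)) (injective⇒≤ {f = code} code-injective))
    where
    decode : Fin (q ℕ.^ dim n D) → Poly n D
    decode = Inverse.from (Poly↔Fin n D)
    conditions : Poly n D → Fin (length K) → Fin (q ℕ.^ dim n m)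
    conditions f j = Inverse.to (Poly↔Fin n m) (truncate m (translate (lookup K j) f))
    code : Fin (q ℕ.^ dim n D) → Fin ((q ℕ.^ dim n m) ℕ.^ length K)
    code i = funToFin (conditions (decode i))
    code-injective : ∀ {i j} → code i ≡ code j → i ≡ j
    code-injective {i} {j} e = Injection.injective (↔⇒↣ (↔-sym (Poly↔Fin n D)))
      (f-g≡𝟘⇒f≡g f g (unisolvent (f +[ - 1# ] g) vanish))
      where
      f = decode i
      g = decode j
      same : ∀ r → truncate m (translate (lookup K r) f) ≡ truncate m (translate (lookup K r) g)
      same r = Injection.injective (↔⇒↣ (Poly↔Fin n m)) (trans (sym (finToFun-funToFin (conditions f) r))
        (trans (cong (λ z → finToFun z r) e) (finToFun-funToFin (conditions g) r)))
      vanish : VanishingOn m K (f +[ - 1# ] g)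
      vanish {k} k∈K = begin
        truncate m (translate k (f +[ - 1# ] g))
          ≡⟨ cong (truncate m) (translate-linear k f (- 1#) g) ⟩
        truncate m (translate k f +[ - 1# ] translate k g)
          ≡⟨ truncate-linear m (translate k f) (- 1#) (translate k g) ⟩
        truncate m (translate k f) +[ - 1# ] truncate m (translate k g)
          ≡⟨ cong (_+[ - 1# ] truncate m (translate k g))
               (subst (λ k → truncate m (translate k f) ≡ truncate m (translate k g))
                 (sym (lookup-index k∈K)) (same (Any.index k∈K))) ⟩
        truncate m (translate k g) +[ - 1# ] truncate m (translate k g)
          ≡⟨ f-f≡𝟘 (truncate m (translate k g)) ⟩
        𝟘ₚ ∎
        where open ≡-Reasoning

open import Data.Nat using (_^_; _*_)

theorem3 : (q : ℕ) → IsOddPrimePower q → (F : FiniteField q) →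
    (n : ℕ) → 2 ≤ n → (K : List (Vecs F n)) → Unique K →
    IsConicalKakeya F K → q ^ n ≤ 3 ^ n * length K
theorem3 q odd F (suc n) _ K _ kakeya with PowerBounds.oddPrimePower≥3 odd
... | q′ , refl = PowerBounds.dim-bound⇒power-bound q n (length K) λ l →
  Multiplicity.unisolvent⇒dim≤ F (s≤s (s≤s z≤n)) (q * l) (3 * l) K
    (λ f → Multiplicity.vanishingOn⇒𝟘 F refl l kakeya f ℕ.≤-refl)
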